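{- For each integer $n\ge 1$ let $m(n)$ denote the minimum of $M(\mathcal{G})$ over all connected graphs $\mathcal{G}$ with $n$ vertices. Then for each integer $n\ge 1$ $$m(n)=\left\lfloor\frac{(n+1)^2}{4}\right\rfloor=\left\lfloor\frac{n+1}{2}\right\rfloor\cdot\left\lceil\frac{n+1}{2}\right\rceil.$$
   Context: Graphs are finite, simple and undirected. For a graph $\mathcal{G}$ with $n$ vertices and adjacency matrix $A$, viewed over $\mathbb{F}_2$, let $C(\mathcal{G})\subseteq\mathbb{F}_2^{2n}$ be the binary linear code generated by the rows of $[I_n|A]$, where $I_n$ is the $n\times n$ identity matrix. The support of a vector is the set of positions of its nonzero entries. A nonzero codeword $c$ of a binary linear code $C$ is minimal if there is no nonzero codeword $c'\in C$ with $\operatorname{supp}(c')\subsetneq\operatorname{supp}(c)$. $M(\mathcal{G})$ denotes the number of minimal codewords of $C(\mathcal{G})$; it does not depend on the labeling of the vertices. -}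

module Defs where

open import Algebra.Bundles using (CommutativeRing)
import Algebra.Properties.Monoid.Sum as MonoidSum
open import Data.Bool.Base using (Bool; true; false; _∧_)
open import Data.Bool.Properties using (xor-∧-commutativeRing)
import Data.Bool.Properties as Bool
open import Data.Fin.Base using (Fin)
import Data.Fin.Properties as Fin
open import Data.Fin.Subset using (Subset; _⊂_)
open import Data.Fin.Subset.Properties using (anySubset?; _⊂?_)
open import Data.List.Base using (List; []; _∷_; length; filter; cartesianProductWith)
open import Data.List.Membership.Propositional using (_∈_)
open import Data.List.Membership.Propositional.Properties using (∈-cartesianProductWith⁺)
open import Data.List.Relation.Unary.All using ([]; _∷_)
open import Data.List.Relation.Unary.AllPairs using ([]; _∷_)
open import Data.List.Relation.Unary.Any using (here; there)
open import Data.List.Relation.Unary.Unique.Propositional using (Unique)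
open import Data.List.Relation.Unary.Unique.Propositional.Properties using (cartesianProductWith⁺)
open import Data.Nat.Base using (ℕ; zero; suc; _+_; _≤_)
open import Data.Product.Base using (_×_; ∃-syntax)
open import Data.Vec.Base using (Vec; []; _∷_; _++_; tabulate; lookup; replicate)
import Data.Vec.Properties as Vec
open import Level using (0ℓ)
open import Relation.Binary.Core using (Rel)
open import Relation.Binary.Construct.Closure.ReflexiveTransitive using (Star)
open import Relation.Binary.Definitions using (Symmetric; Irreflexive; Decidable; DecidableEquality)
open import Relation.Binary.PropositionalEquality.Core using (_≡_; _≢_; refl)
open import Relation.Nullary.Decidable using (does; _×-dec_; ¬?)
open import Relation.Nullary.Negation.Core using (¬_)
import Relation.Unary as U

record Graph (n : ℕ) : Set₁ where
  infix 4 _~_ _~?_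
  field
    _~_    : Rel (Fin n) 0ℓ
    _~?_   : Decidable _~_
    sym    : Symmetric _~_
    irrefl : Irreflexive _≡_ _~_

Connected : ∀ {n} → Graph n → Set
Connected G = ∀ u v → Star (Graph._~_ G) u v

-- The field with two elements is Bool with _xor_ as addition and _∧_ as
-- multiplication, so 0 is false and 1 is true.

𝔽₂ : Set
𝔽₂ = Bool

open MonoidSum (CommutativeRing.+-monoid xor-∧-commutativeRing) using (sum-syntax)

_≟_ : ∀ {m} → DecidableEquality (Vec 𝔽₂ m)
_≟_ = Vec.≡-dec Bool._≟_

𝟎 : ∀ {m} → Vec 𝔽₂ m
𝟎 = replicate _ false

-- A vector over 𝔽₂ has a 1 exactly at its nonzero entries, and Subset m is
-- Vec Bool m with true marking membership, so it is its own support.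

supp : ∀ {m} → Vec 𝔽₂ m → Subset m
supp c = c

linearCombination : ∀ {k m} → Vec 𝔽₂ k → (Fin k → Vec 𝔽₂ m) → Vec 𝔽₂ m
linearCombination {k} x row =
  tabulate λ j → ∑[ i < k ] (lookup x i ∧ lookup (row i) j)

RowSpan : ∀ {k m} → (Fin k → Vec 𝔽₂ m) → U.Pred (Vec 𝔽₂ m) 0ℓ
RowSpan {k} row c = ∃[ x ] linearCombination {k} x row ≡ c

rowSpan? : ∀ {k m} (row : Fin k → Vec 𝔽₂ m) → U.Decidable (RowSpan row)
rowSpan? row c = anySubset? λ x → linearCombination x row ≟ c

module _ {m : ℕ} (C : U.Pred (Vec 𝔽₂ m) 0ℓ) where

  NonzeroCodeword : U.Pred (Vec 𝔽₂ m) 0ℓ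
  NonzeroCodeword c = C c × c ≢ 𝟎

  MinimalCodeword : U.Pred (Vec 𝔽₂ m) 0ℓ
  MinimalCodeword c =
    NonzeroCodeword c × ¬ (∃[ c′ ] NonzeroCodeword c′ × supp c′ ⊂ supp c)

  minimalCodeword? : U.Decidable C → U.Decidable MinimalCodeword
  minimalCodeword? C? c =
    nonzero? c ×-dec ¬? (anySubset? λ c′ → nonzero? c′ ×-dec (supp c′ ⊂? supp c))
    where
    nonzero? : U.Decidable NonzeroCodeword
    nonzero? c = C? c ×-dec ¬? (c ≟ 𝟎)

bits : List 𝔽₂
bits = false ∷ true ∷ []

allVectors : ∀ m → List (Vec 𝔽₂ m)
allVectors zero    = [] ∷ []
allVectors (suc m) = cartesianProductWith _∷_ bits (allVectors m)

-- The next two facts make the length of a filtered allVectors m the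
-- cardinality of the corresponding set of vectors.

allVectors-complete : ∀ {m} (v : Vec 𝔽₂ m) → v ∈ allVectors m
allVectors-complete []      = here refl
allVectors-complete (b ∷ v) =
  ∈-cartesianProductWith⁺ _∷_ {xs = bits} (bit∈bits b) (allVectors-complete v)
  where
  bit∈bits : ∀ b → b ∈ bits
  bit∈bits false = here refl
  bit∈bits true  = there (here refl)

allVectors-unique : ∀ m → Unique (allVectors m)
allVectors-unique zero    = [] ∷ []
allVectors-unique (suc m) =
  cartesianProductWith⁺ _∷_ Vec.∷-injective
    (((λ ()) ∷ []) ∷ [] ∷ []) (allVectors-unique m)

module _ {n : ℕ} (G : Graph n) where
  open Graph G

  adjacencyMatrix : Fin n → Vec 𝔽₂ n
  adjacencyMatrix i = tabulate λ j → does (i ~? j)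

  identityMatrix : Fin n → Vec 𝔽₂ n
  identityMatrix i = tabulate λ j → does (i Fin.≟ j)

  generatorMatrix : Fin n → Vec 𝔽₂ (n + n)
  generatorMatrix i = identityMatrix i ++ adjacencyMatrix i

  Code : U.Pred (Vec 𝔽₂ (n + n)) 0ℓ
  Code = RowSpan generatorMatrix

  M : ℕ
  M = length (filter (minimalCodeword? Code (rowSpan? generatorMatrix))
                     (allVectors (n + n)))

_IsMinimumOf_ : ∀ {ℓ} → ℕ → U.Pred ℕ ℓ → Set ℓ
k IsMinimumOf P = P k × (∀ j → P j → k ≤ j)

{-# OPTIONS --safe #-}

module Submission where

-- Write encode x = (x , xA) for the codeword of a set x of vertices. Since
-- encode y + encode z = encode x when y + z = x, a proper nonempty part y of x
-- gives a smaller codeword exactly when no vertex has an odd number of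
-- neighbours both in y and in the rest of x.
--
-- Lower bound. Call two vertices related if they have a common neighbour, and
-- let x be the vertex set of an induced path of this relation. Consecutive
-- vertices of the path have a common neighbour, and that neighbour is adjacent
-- to no other vertex of x; so a codeword below encode x must contain both of
-- them or neither, and encode x is minimal (inducedPath-minimal). The ends of
-- the path can be recovered from x, as its vertices related to at most one
-- other vertex of x (same-ends). Hence every unordered pair of vertices, equal
-- or not, joined by a walk of even length has a minimal codeword of its own.
-- In a connected graph, split the vertices by the parity of a chosen walk from
-- a fixed root: two vertices in one class are joined by a walk of even length.
-- With classes of sizes a and b this gives at least a(a+1)/2 + b(b+1)/2
-- minimal codewords, and
--   2 (a(a+1) + b(b+1)) + 1 = (n+1)^2 + (a-b)^2   where n = a + b,
-- so that number is at least the integer part of (n+1)^2 / 4.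
--
-- Upper bound. In a complete bipartite graph, let encode x be a minimal
-- codeword. If x has two vertices i and j on the same side, then
-- encode {i, j} = ({i, j} , 0) is below encode x. If some side meets x in one
-- vertex i only, then encode {i} is below encode x. So x has at most two
-- elements, both on one side (minimal⇒pairCodeword), and there are at most
-- a(a+1)/2 + b(b+1)/2 minimal codewords. When the sizes a and b of the sides
-- are n/2 rounded up and down, this is the integer part of (n+1)^2 / 4.

open import Defs hiding (_≟_)
open import Algebra.Bundles using (CommutativeRing)
import Algebra.Properties.Monoid.Sum as MonoidSum
open import Data.Bool.Base using (Bool; true; false; _∧_; _xor_)
import Data.Bool.Properties as Bool
open import Data.Fin.Base using (Fin; zero; suc; _↑ˡ_; _↑ʳ_; splitAt)
open import Data.Fin.Properties
  using (_≟_; any?; suc-injective; splitAt⁻¹-↑ˡ; splitAt⁻¹-↑ʳ)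
open import Data.Fin.Subset using (_⊆_; _⊂_)
open import Data.Fin.Subset.Properties using (⊆-antisym; ⊂-irref; _∈?_)
open import Data.List.Base
  using (List; []; _∷_; _++_; map; length; filter; allFin; tabulate; drop)
import Data.List.Membership.DecPropositional as DecMembership
open import Data.List.Membership.Propositional using (_∈_; _∉_)
open import Data.List.Membership.Propositional.Properties
  using (∈-map⁺; ∈-filter⁺; ∈-filter⁻; ∈-++⁺ˡ; ∈-++⁺ʳ; ∈-allFin)
open import Data.List.Properties
  using (length-map; length-++; length-removeAt′; length-tabulate)
open import Data.List.Relation.Unary.All as All using (All; []; _∷_)
import Data.List.Relation.Unary.All.Properties as All
open import Data.List.Relation.Unary.AllPairs as AllPairs using (AllPairs; []; _∷_)
import Data.List.Relation.Unary.AllPairs.Properties as AllPairs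
open import Data.List.Relation.Unary.Any as Any using (Any; here; there; _─_)
open import Data.List.Relation.Unary.Unique.Propositional using (Unique)
import Data.List.Relation.Unary.Unique.Propositional.Properties as Unique
open import Data.Nat.Base
  using (ℕ; zero; suc; z≤n; s≤s; _+_; _*_; _^_; _/_; _≤_; _<_; _≥_; ⌊_/2⌋; ⌈_/2⌉)
open import Data.Nat.Divisibility using (divides)
open import Data.Nat.DivMod using (m*n/n≡m; +-distrib-/-∣ʳ; m<n*o⇒m/o<n)
import Data.Nat.Properties as ℕ
open import Data.Nat.Tactic.RingSolver using (solve-∀)
open import Data.Product.Base using (_×_; _,_; ∃-syntax; proj₁; proj₂)
open import Data.Sum.Base using (_⊎_; inj₁; inj₂)
open import Data.Vec.Base as Vec using (Vec; lookup)
import Data.Vec.Properties as Vec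
open import Function.Base using (_∘_)
open import Level using (0ℓ)
open import Relation.Binary.Construct.Closure.ReflexiveTransitive
  using (Star; ε; _◅_; _◅◅_; reverse)
open import Relation.Binary.Core using (Rel)
open import Relation.Binary.Definitions using (Symmetric; Decidable; DecidableEquality)
open import Relation.Binary.PropositionalEquality
  using (_≡_; _≢_; refl; sym; trans; cong; cong₂; subst; module ≡-Reasoning)
open import Relation.Nullary.Decidable
  using (Dec; yes; no; does; ¬?; _×-dec_; _⊎-dec_; dec-true; dec-false; decidable-stable)
open import Relation.Nullary.Negation.Core using (¬_; contradiction)

open MonoidSum (CommutativeRing.+-monoid Bool.xor-∧-commutativeRing) using (sum; sum-cong-≗)

private variable
  A B : Set
  n : ℕ

infix 4 _≈_

-- Counting by injections between lists

∈-─⁺ : ∀ {x y : A} {zs} (x∈zs : x ∈ zs) → y ∈ zs → x ≢ y → y ∈ (zs ─ x∈zs)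
∈-─⁺ (here refl)  (here refl)  x≢y = contradiction refl x≢y
∈-─⁺ (here refl)  (there y∈zs) x≢y = y∈zs
∈-─⁺ (there x∈zs) (here refl)  x≢y = here refl
∈-─⁺ (there x∈zs) (there y∈zs) x≢y = there (∈-─⁺ x∈zs y∈zs x≢y)

-- If every entry of xs is P-related to some entry of zs, and different entries
-- of xs are never P-related to the same object, then xs is no longer than zs.
-- Being different is expressed by a relation D, which allows entries of xs to
-- be compared up to an equivalence.
pigeonhole : {P : A → B → Set} {D : Rel A 0ℓ} →
  (∀ {x y z} → D x y → P x z → ¬ P y z) →
  ∀ {xs zs} → AllPairs D xs → All (λ x → ∃[ z ] z ∈ zs × P x z) xs →
  length xs ≤ length zs
pigeonhole                 _     {[]}              _               _ = z≤n
pigeonhole {P = P} {D = D} apart {x ∷ xs} {zs} (x#xs ∷ xs#) ((z , z∈zs , xz) ∷ images) =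
  subst (suc (length xs) ≤_) (sym (length-removeAt′ zs (Any.index z∈zs)))
    (s≤s (pigeonhole {P = P} apart xs# (All.zipWith avoid (x#xs , images))))
  where
  avoid : ∀ {y} → D x y × ∃[ z′ ] (z′ ∈ zs × P y z′) →
          ∃[ z′ ] z′ ∈ (zs ─ z∈zs) × P y z′
  avoid (xy , z′ , z′∈zs , yz′) =
    z′ , ∈-─⁺ z∈zs z′∈zs (λ { refl → apart xy xz yz′ }) , yz′

Unique⇒length≤ : ∀ {xs ys : List A} → Unique xs → (∀ {x} → x ∈ xs → x ∈ ys) →
                 length xs ≤ length ys
Unique⇒length≤ xs! xs⊆ys =
  pigeonhole {P = _≡_} (λ x≢y x≡z y≡z → x≢y (trans x≡z (sym y≡z))) xs!
    (All.tabulate λ x∈xs → _ , xs⊆ys x∈xs , refl)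

-- The triangular number k(k+1)/2, which counts the unordered pairs, with
-- repetition, of k objects.
triangle : ℕ → ℕ
triangle zero    = zero
triangle (suc k) = suc k + triangle k

-- The unordered pairs, with repetition, of entries of a list; each one is
-- represented once, its components being in the order of the list.
pairs : List A → List (A × A)
pairs []       = []
pairs (x ∷ xs) = map (x ,_) (x ∷ xs) ++ pairs xs

-- Equality of unordered pairs.
_≈_ : Rel (A × A) 0ℓ
(a , b) ≈ (c , d) = (a ≡ c × b ≡ d) ⊎ (a ≡ d × b ≡ c)

length-pairs : (xs : List A) → length (pairs xs) ≡ triangle (length xs)
length-pairs []       = refl
length-pairs (x ∷ xs) = trans (length-++ (map (x ,_) (x ∷ xs)))
  (cong₂ _+_ (length-map (x ,_) (x ∷ xs)) (length-pairs xs))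

∈-pairs⁺ : ∀ {x y : A} {xs} → x ∈ xs → y ∈ xs → (x , y) ∈ pairs xs ⊎ (y , x) ∈ pairs xs
∈-pairs⁺ (here refl) y∈          = inj₁ (∈-++⁺ˡ (∈-map⁺ _ y∈))
∈-pairs⁺ x∈          (here refl) = inj₂ (∈-++⁺ˡ (∈-map⁺ _ x∈))
∈-pairs⁺ {xs = z ∷ xs} (there x∈)  (there y∈) with ∈-pairs⁺ x∈ y∈
... | inj₁ xy = inj₁ (∈-++⁺ʳ (map (z ,_) (z ∷ xs)) xy)
... | inj₂ yx = inj₂ (∈-++⁺ʳ (map (z ,_) (z ∷ xs)) yx)

All-pairs⁺ : {P : A → Set} → ∀ {xs} → All P xs → All (λ (x , y) → P x × P y) (pairs xs)
All-pairs⁺ []         = []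
All-pairs⁺ (px ∷ pxs) =
  All.++⁺ (All.map⁺ (All.map (px ,_) (px ∷ pxs))) (All-pairs⁺ pxs)

pairs-apart : ∀ {xs : List A} → Unique xs → AllPairs (λ p q → ¬ p ≈ q) (pairs xs)
pairs-apart []                       = []
pairs-apart {xs = x ∷ xs} (x∉ ∷ xs!) = AllPairs.++⁺
  (AllPairs.map⁺ (AllPairs.map (λ { y≢z (inj₁ (_ , y≡z)) → y≢z y≡z
                                  ; y≢z (inj₂ (x≡z , y≡x)) → y≢z (trans y≡x x≡z) })
                               (x∉ ∷ xs!)))
  (pairs-apart xs!)
  (All.map⁺ (All.tabulate λ _ → All.map
    (λ { (x≢c , x≢d) (inj₁ (x≡c , _)) → x≢c x≡c
       ; (x≢c , x≢d) (inj₂ (x≡d , _)) → x≢d x≡d }) (All-pairs⁺ x∉)))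

-- A colouring of the vertices by Bool is a partition into two classes.
colourClass : (Fin n → Bool) → Bool → List (Fin n)
colourClass κ b = filter (λ i → κ i Bool.≟ b) (allFin _)

-- The unordered pairs, with repetition, of vertices of equal colour.
monochromaticPairs : (Fin n → Bool) → List (Fin n × Fin n)
monochromaticPairs κ = pairs (colourClass κ true) ++ pairs (colourClass κ false)

length-monochromaticPairs : (κ : Fin n → Bool) → length (monochromaticPairs κ) ≡
  triangle (length (colourClass κ true)) + triangle (length (colourClass κ false))
length-monochromaticPairs κ = trans (length-++ (pairs (colourClass κ true)))
  (cong₂ _+_ (length-pairs (colourClass κ true)) (length-pairs (colourClass κ false)))

colourClass-colour : (κ : Fin n → Bool) (b : Bool) → All (λ i → κ i ≡ b) (colourClass κ b)
colourClass-colour κ b = All.all-filter (λ i → κ i Bool.≟ b) (allFin _)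

monochromatic : (κ : Fin n → Bool) →
  All (λ (i , j) → κ i ≡ κ j) (monochromaticPairs κ)
monochromatic κ = All.++⁺ (in-class true) (in-class false)
  where
  in-class : ∀ b → All (λ (i , j) → κ i ≡ κ j) (pairs (colourClass κ b))
  in-class b = All.map (λ (i≡b , j≡b) → trans i≡b (sym j≡b))
                       (All-pairs⁺ (colourClass-colour κ b))

∈-monochromaticPairs : (κ : Fin n → Bool) → ∀ {i j} → κ i ≡ κ j →
  (i , j) ∈ monochromaticPairs κ ⊎ (j , i) ∈ monochromaticPairs κ
∈-monochromaticPairs κ {i} {j} i≡j with κ j in j≡b
... | b with ∈-pairs⁺ (∈-filter⁺ (λ k → κ k Bool.≟ b) (∈-allFin i) i≡j)
                      (∈-filter⁺ (λ k → κ k Bool.≟ b) (∈-allFin j) j≡b)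
∈-monochromaticPairs κ i≡j | true  | inj₁ ij = inj₁ (∈-++⁺ˡ ij)
∈-monochromaticPairs κ i≡j | true  | inj₂ ji = inj₂ (∈-++⁺ˡ ji)
∈-monochromaticPairs κ i≡j | false | inj₁ ij = inj₁ (∈-++⁺ʳ (pairs (colourClass κ true)) ij)
∈-monochromaticPairs κ i≡j | false | inj₂ ji = inj₂ (∈-++⁺ʳ (pairs (colourClass κ true)) ji)

monochromaticPairs-apart : (κ : Fin n → Bool) →
  AllPairs (λ p q → ¬ p ≈ q) (monochromaticPairs κ)
monochromaticPairs-apart κ = AllPairs.++⁺ (class-apart true) (class-apart false)
  (All.map (λ (i≡t , j≡t) → All.map (λ (k≡f , l≡f) →
      λ { (inj₁ (refl , _)) → contradiction (trans (sym i≡t) k≡f) λ ()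
        ; (inj₂ (refl , _)) → contradiction (trans (sym i≡t) l≡f) λ () })
    (All-pairs⁺ (colourClass-colour κ false)))
    (All-pairs⁺ (colourClass-colour κ true)))
  where
  class-apart : ∀ b → AllPairs (λ p q → ¬ p ≈ q) (pairs (colourClass κ b))
  class-apart b = pairs-apart (Unique.filter⁺ (λ i → κ i Bool.≟ b) (Unique.allFin⁺ _))

colourClasses-partition : (κ : Fin n → Bool) →
  length (colourClass κ true) + length (colourClass κ false) ≡ n
colourClasses-partition {n} κ = trans (split (allFin n)) (length-tabulate (λ (i : Fin n) → i))
  where
  split : ∀ xs → length (filter (λ i → κ i Bool.≟ true) xs)
               + length (filter (λ i → κ i Bool.≟ false) xs) ≡ length xs
  split []       = refl
  split (x ∷ xs) with κ x
  ... | true  = cong suc (split xs)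
  ... | false = trans (ℕ.+-suc _ _) (cong suc (split xs))

-- Triangular numbers and quarter squares

2*triangle : ∀ k → 2 * triangle k ≡ k * suc k
2*triangle zero    = refl
2*triangle (suc k) = begin
  2 * (suc k + triangle k)     ≡⟨ ℕ.*-distribˡ-+ 2 (suc k) (triangle k) ⟩
  2 * suc k + 2 * triangle k   ≡⟨ cong (2 * suc k +_) (2*triangle k) ⟩
  2 * suc k + k * suc k        ≡⟨ expand k ⟩
  suc k * suc (suc k)          ∎
  where
  open ≡-Reasoning
  expand : ∀ k → 2 * suc k + k * suc k ≡ suc k * suc (suc k)
  expand = solve-∀

-- With b = a + d, the square and d * d add up to one more than four times the
-- sum of the two triangular numbers, and the division by four drops that one.
quarter-square≤ : ∀ a b → (a + b + 1) ^ 2 / 4 ≤ triangle a + triangle b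
quarter-square≤ a b = ℕ.≤-pred (m<n*o⇒m/o<n (bound (ℕ.≤-total a b)))
  where
  open ℕ.≤-Reasoning
  -- The square is unfolded from m ^ 2 to m * (m * 1).
  complete : ∀ a d → (a + (a + d) + 1) * ((a + (a + d) + 1) * 1) + d * d
                   ≡ 1 + 2 * (a * suc a + (a + d) * (1 + (a + d)))
  complete = solve-∀
  collect : ∀ s t → 4 + 2 * (2 * s + 2 * t) ≡ suc (s + t) * 4
  collect = solve-∀
  ordered : ∀ a d → (a + (a + d) + 1) ^ 2 < suc (triangle a + triangle (a + d)) * 4
  ordered a d = begin-strict
    (a + (a + d) + 1) ^ 2
      ≤⟨ ℕ.m≤m+n _ (d * d) ⟩
    (a + (a + d) + 1) ^ 2 + d * d
      ≡⟨ complete a d ⟩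
    1 + 2 * (a * suc a + (a + d) * (1 + (a + d)))
      ≡⟨ cong₂ (λ s t → 1 + 2 * (s + t)) (2*triangle a) (2*triangle (a + d)) ⟨
    1 + 2 * (2 * triangle a + 2 * triangle (a + d))
      <⟨ ℕ.+-monoˡ-< (2 * (2 * triangle a + 2 * triangle (a + d))) {1} {4} (s≤s (s≤s z≤n)) ⟩
    4 + 2 * (2 * triangle a + 2 * triangle (a + d))
      ≡⟨ collect (triangle a) (triangle (a + d)) ⟩
    suc (triangle a + triangle (a + d)) * 4 ∎
  bound : a ≤ b ⊎ b ≤ a → (a + b + 1) ^ 2 < suc (triangle a + triangle b) * 4
  bound (inj₁ a≤b) with d , refl ← ℕ.m≤n⇒∃[o]m+o≡n a≤b = ordered a d
  bound (inj₂ b≤a) with d , refl ← ℕ.m≤n⇒∃[o]m+o≡n b≤a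
    rewrite ℕ.+-comm (b + d) b | ℕ.+-comm (triangle (b + d)) (triangle b) = ordered b d

quarter-square-step : ∀ n → (suc (suc n) + 1) ^ 2 / 4 ≡ (n + 1) ^ 2 / 4 + (n + 2)
quarter-square-step n = begin
  (suc (suc n) + 1) ^ 2 / 4           ≡⟨ cong (_/ 4) (expand n) ⟩
  ((n + 1) ^ 2 + (n + 2) * 4) / 4     ≡⟨ +-distrib-/-∣ʳ ((n + 1) ^ 2) (divides (n + 2) refl) ⟩
  (n + 1) ^ 2 / 4 + (n + 2) * 4 / 4   ≡⟨ cong ((n + 1) ^ 2 / 4 +_) (m*n/n≡m (n + 2) 4) ⟩
  (n + 1) ^ 2 / 4 + (n + 2)           ∎
  where
  open ≡-Reasoning
  -- m ^ 2 unfolds to m * (m * 1).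
  expand : ∀ n → (2 + n + 1) * ((2 + n + 1) * 1) ≡ (n + 1) * ((n + 1) * 1) + (n + 2) * 4
  expand = solve-∀

quarter-square-triangle : ∀ n → (n + 1) ^ 2 / 4 ≡ triangle ⌈ n /2⌉ + triangle ⌊ n /2⌋
quarter-square-triangle 0 = refl
quarter-square-triangle 1 = refl
quarter-square-triangle (suc (suc n)) = begin
  (suc (suc n) + 1) ^ 2 / 4
    ≡⟨ quarter-square-step n ⟩
  (n + 1) ^ 2 / 4 + (n + 2)
    ≡⟨ cong₂ (λ s m → s + (m + 2)) (quarter-square-triangle n) (sym (ℕ.⌊n/2⌋+⌈n/2⌉≡n n)) ⟩
  triangle q + triangle p + (p + q + 2)
    ≡⟨ regroup p q (triangle p) (triangle q) ⟩
  suc q + triangle q + (suc p + triangle p) ∎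
  where
  open ≡-Reasoning
  p q : ℕ
  p = ⌊ n /2⌋
  q = ⌈ n /2⌉
  regroup : ∀ p q s t → t + s + (p + q + 2) ≡ suc q + t + (suc p + s)
  regroup = solve-∀

quarter-square-product : ∀ n → (n + 1) ^ 2 / 4 ≡ ⌊ n + 1 /2⌋ * ⌈ n + 1 /2⌉
quarter-square-product 0 = refl
quarter-square-product 1 = refl
quarter-square-product (suc (suc n)) = begin
  (suc (suc n) + 1) ^ 2 / 4
    ≡⟨ quarter-square-step n ⟩
  (n + 1) ^ 2 / 4 + (n + 2)
    ≡⟨ cong ((n + 1) ^ 2 / 4 +_) (ℕ.+-assoc n 1 1) ⟨
  (n + 1) ^ 2 / 4 + (n + 1 + 1)
    ≡⟨ cong₂ (λ s m → s + (m + 1)) (quarter-square-product n) (sym (ℕ.⌊n/2⌋+⌈n/2⌉≡n (n + 1))) ⟩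
  p * q + (p + q + 1)
    ≡⟨ regroup p q ⟩
  suc p * suc q ∎
  where
  open ≡-Reasoning
  p q : ℕ
  p = ⌊ n + 1 /2⌋
  q = ⌈ n + 1 /2⌉
  regroup : ∀ p q → p * q + (p + q + 1) ≡ suc p * suc q
  regroup = solve-∀

-- Sums over 𝔽₂ with small support

sum-zero : ∀ {f : Fin n → Bool} → (∀ i → f i ≡ false) → sum f ≡ false
sum-zero {zero}  f≡0 = refl
sum-zero {suc n} f≡0 = cong₂ _xor_ (f≡0 zero) (sum-zero (f≡0 ∘ suc))

sum-one : ∀ {f : Fin n → Bool} p → (∀ i → i ≢ p → f i ≡ false) → sum f ≡ f p
sum-one {f = f} zero    f≡0 =
  trans (cong (f zero xor_) (sum-zero λ i → f≡0 (suc i) λ ())) (Bool.xor-identityʳ (f zero))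
sum-one         (suc p) f≡0 = cong₂ _xor_ (f≡0 zero λ ())
  (sum-one p λ i i≢p → f≡0 (suc i) (i≢p ∘ suc-injective))

sum-two : ∀ {f : Fin n → Bool} {p q} → p ≢ q →
          (∀ i → i ≢ p → i ≢ q → f i ≡ false) → sum f ≡ f p xor f q
sum-two         {p = zero}  {zero}  p≢q f≡0 = contradiction refl p≢q
sum-two {f = f} {p = zero}  {suc q} p≢q f≡0 = cong (f zero xor_)
  (sum-one q λ i i≢q → f≡0 (suc i) (λ ()) (i≢q ∘ suc-injective))
sum-two {f = f} {p = suc p} {zero}  p≢q f≡0 = trans
  (cong (f zero xor_) (sum-one p λ i i≢p → f≡0 (suc i) (i≢p ∘ suc-injective) λ ()))
  (Bool.xor-comm (f zero) (f (suc p)))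
sum-two         {p = suc p} {suc q} p≢q f≡0 = cong₂ _xor_ (f≡0 zero (λ ()) λ ())
  (sum-two (p≢q ∘ cong suc) λ i i≢p i≢q →
    f≡0 (suc i) (i≢p ∘ suc-injective) (i≢q ∘ suc-injective))

-- Vectors over 𝔽₂ as sets of coordinates

lookup-ext : ∀ {x y : Vec A n} → (∀ i → lookup x i ≡ lookup y i) → x ≡ y
lookup-ext {x = x} {y} x≗y = trans (sym (Vec.tabulate∘lookup x))
  (trans (Vec.tabulate-cong x≗y) (Vec.tabulate∘lookup y))

⊆⁺ : ∀ {x y : Vec Bool n} → (∀ i → lookup x i ≡ true → lookup y i ≡ true) → x ⊆ y
⊆⁺ {x = x} {y} x≤y {i} i∈x = Vec.lookup⇒[]= i y (x≤y i (Vec.[]=⇒lookup i∈x))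

⊆⁻ : ∀ {x y : Vec Bool n} → x ⊆ y → ∀ i → lookup x i ≡ true → lookup y i ≡ true
⊆⁻ {x = x} x⊆y i xi = Vec.[]=⇒lookup (x⊆y (Vec.lookup⇒[]= i x xi))

_∈ᴸ?_ : (i : Fin n) (xs : List (Fin n)) → Dec (i ∈ xs)
_∈ᴸ?_ = DecMembership._∈?_ _≟_

-- The characteristic vector of the set of entries of a list.
indicator : List (Fin n) → Vec Bool n
indicator xs = Vec.tabulate λ i → does (i ∈ᴸ? xs)

indicator⁺ : ∀ (xs : List (Fin n)) {i} → i ∈ xs → lookup (indicator xs) i ≡ true
indicator⁺ xs {i} i∈xs =
  trans (Vec.lookup∘tabulate _ i) (dec-true (i ∈ᴸ? xs) i∈xs)

indicator⁻ : ∀ (xs : List (Fin n)) {i} → lookup (indicator xs) i ≡ true → i ∈ xs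
indicator⁻ xs {i} eq with i ∈ᴸ? xs | trans (sym (Vec.lookup∘tabulate _ i)) eq
... | yes i∈xs | _ = i∈xs

indicator-swap : (i j : Fin n) → indicator (i ∷ j ∷ []) ≡ indicator (j ∷ i ∷ [])
indicator-swap i j = ⊆-antisym (⊆⁺ λ _ → swapped i j) (⊆⁺ λ _ → swapped j i)
  where
  swap : ∀ {i j k : Fin n} → k ∈ i ∷ j ∷ [] → k ∈ j ∷ i ∷ []
  swap (here k≡i)         = there (here k≡i)
  swap (there (here k≡j)) = here k≡j
  swapped : ∀ (i j : Fin n) {k} → lookup (indicator (i ∷ j ∷ [])) k ≡ true →
            lookup (indicator (j ∷ i ∷ [])) k ≡ true
  swapped i j k∈ = indicator⁺ (j ∷ i ∷ []) (swap (indicator⁻ (i ∷ j ∷ []) k∈))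

-- Induced paths of a symmetric relation

module InducedPaths {V : Set} (_≟ⱽ_ : DecidableEquality V)
  (_R_ : Rel V 0ℓ) (_R?_ : Decidable _R_) (R-sym : Symmetric _R_) where

  -- Closed neighbourhoods in the graph of R.
  Near : Rel V 0ℓ
  Near u v = u ≡ v ⊎ u R v

  near? : Decidable Near
  near? u v = (u ≟ⱽ v) ⊎-dec (u R? v)

  -- InducedPath u w xs: the list xs is a path from u to w in the graph of R, its
  -- vertices are distinct, and no two of them other than consecutive ones are
  -- related. The relation R may or may not hold between a vertex and itself.
  data InducedPath : V → V → List V → Set where
    stop : ∀ {u} → InducedPath u u (u ∷ [])
    step : ∀ {u v w vs} → u R v → u ≢ v → All (λ z → ¬ Near u z) vs →
           InducedPath v w (v ∷ vs) → InducedPath u w (u ∷ v ∷ vs)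

  -- A vertex near some vertex of an induced path can be joined to its end by an
  -- induced path: follow the path from its last vertex near u.
  prepend : ∀ {u v w vs} → InducedPath v w vs → Any (Near u) vs →
            ∃[ us ] InducedPath u w us
  prepend stop             (here (inj₁ refl)) = _ , stop
  prepend p@(step _ _ _ _) (here (inj₁ refl)) = _ , p
  prepend (step _ _ _ p)   (there near)       = prepend p near
  prepend {u} {v} stop     (here (inj₂ r)) with u ≟ⱽ v
  ... | yes refl = _ , stop
  ... | no  u≢v  = _ , step r u≢v [] stop
  prepend {u} {v} q@(step _ _ _ p) (here (inj₂ r)) with u ≟ⱽ v
  ... | yes refl = _ , q
  ... | no  u≢v with Any.any? (near? u) _
  ...   | yes near  = prepend p near
  ...   | no  ¬near = _ , step r u≢v (All.¬Any⇒All¬ _ ¬near) q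

  start∈ : ∀ {u w xs} → InducedPath u w xs → u ∈ xs
  start∈ stop           = here refl
  start∈ (step _ _ _ _) = here refl

  end∈ : ∀ {u w xs} → InducedPath u w xs → w ∈ xs
  end∈ stop           = here refl
  end∈ (step _ _ _ p) = there (end∈ p)

  inducedPath : ∀ {u w} → Star _R_ u w → ∃[ xs ] InducedPath u w xs
  inducedPath ε       = _ , stop
  inducedPath {u} (r ◅ s) with _ , p ← inducedPath s =
    prepend p (Any.map (λ v≡z → inj₂ (subst (u R_) v≡z r)) (start∈ p))

  -- A vertex of xs that is related to at most one other vertex of xs. This
  -- depends on the entries of xs only, and not on their order.
  Endpoint : List V → V → Set
  Endpoint xs u = u ∈ xs ×
    (∀ {p q} → p ∈ xs → q ∈ xs → p ≢ u → q ≢ u → u R p → u R q → p ≡ q)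

  start-endpoint : ∀ {u w xs} → InducedPath u w xs → Endpoint xs u
  start-endpoint stop = here refl , λ { (here p≡u) _ p≢u → contradiction p≡u p≢u }
  start-endpoint (step {u} {v} {vs = vs} _ _ far _) =
    here refl , λ p∈ q∈ p≢u q≢u up uq →
      trans (neighbour p∈ p≢u up) (sym (neighbour q∈ q≢u uq))
    where
    neighbour : ∀ {p} → p ∈ u ∷ v ∷ vs → p ≢ u → u R p → p ≡ v
    neighbour (here p≡u)           p≢u _  = contradiction p≡u p≢u
    neighbour (there (here p≡v))   _   _  = p≡v
    neighbour (there (there p∈vs)) _   up = contradiction (inj₂ up) (All.lookup far p∈vs)

  end-endpoint : ∀ {u w xs} → InducedPath u w xs → Endpoint xs w
  end-endpoint stop = start-endpoint stop
  end-endpoint (step _ _ _ stop) = there (here refl) , λ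
    { (here p≡u)         (here q≡u)         _   _   _ _ → trans p≡u (sym q≡u)
    ; (there (here p≡w)) _                  p≢w _   _ _ → contradiction p≡w p≢w
    ; _                  (there (here q≡w)) _   q≢w _ _ → contradiction q≡w q≢w }
  end-endpoint (step {u} _ _ far path@(step {v} {x} {w} {xs} _ _ _ p))
    with w∈ , unique ← end-endpoint path = there w∈ , λ
    { (here refl) (here refl) _ _ _ _ → refl
    ; (here refl) _ _ _ wu _ → contradiction (inj₂ (R-sym wu)) (All.lookup far (end∈ p))
    ; _ (here refl) _ _ _ wu → contradiction (inj₂ (R-sym wu)) (All.lookup far (end∈ p))
    ; (there p∈) (there q∈) → unique p∈ q∈ }

  endpoint-only : ∀ {u w xs z} → InducedPath u w xs → Endpoint xs z → z ≡ u ⊎ z ≡ w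
  endpoint-only stop           (here z≡u , _)         = inj₁ z≡u
  endpoint-only (step _ _ _ _) (here z≡u , _)         = inj₁ z≡u
  endpoint-only (step r u≢v far path) (there z∈ , unique)
    with endpoint-only path (z∈ , λ p∈ q∈ → unique (there p∈) (there q∈))
  ... | inj₂ z≡w  = inj₂ z≡w
  ... | inj₁ refl with path
  ...   | stop = inj₂ refl
  ...   | step r′ v≢x _ _ = contradiction
    (inj₁ (unique (here refl) (there (there (here refl)))
                  u≢v (v≢x ∘ sym) (R-sym r) r′))
    (All.lookup far (here refl))

  Endpoint-resp : ∀ {xs ys z} →
    (∀ {v} → v ∈ xs → v ∈ ys) → (∀ {v} → v ∈ ys → v ∈ xs) →
    Endpoint xs z → Endpoint ys z
  Endpoint-resp xs⊆ys ys⊆xs (z∈ , unique) =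
    xs⊆ys z∈ , λ p∈ q∈ → unique (ys⊆xs p∈) (ys⊆xs q∈)

  -- The ends of an induced path, up to their order, are determined by its set of
  -- vertices.
  same-ends : ∀ {u w u′ w′ xs ys} → InducedPath u w xs → InducedPath u′ w′ ys →
    (∀ {v} → v ∈ xs → v ∈ ys) → (∀ {v} → v ∈ ys → v ∈ xs) → (u , w) ≈ (u′ , w′)
  same-ends P Q xs⊆ys ys⊆xs
    with endpoint-only Q (Endpoint-resp xs⊆ys ys⊆xs (start-endpoint P))
       | endpoint-only Q (Endpoint-resp xs⊆ys ys⊆xs (end-endpoint P))
       | endpoint-only P (Endpoint-resp ys⊆xs xs⊆ys (start-endpoint Q))
       | endpoint-only P (Endpoint-resp ys⊆xs xs⊆ys (end-endpoint Q))
  ... | inj₁ u≡u′ | inj₂ w≡w′ | _         | _         = inj₁ (u≡u′ , w≡w′)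
  ... | inj₂ u≡w′ | inj₁ w≡u′ | _         | _         = inj₂ (u≡w′ , w≡u′)
  ... | inj₁ u≡u′ | inj₁ _    | _         | inj₂ w′≡w = inj₁ (u≡u′ , sym w′≡w)
  ... | inj₁ u≡u′ | inj₁ w≡u′ | _         | inj₁ w′≡u = inj₂ (sym w′≡u , w≡u′)
  ... | inj₂ u≡w′ | inj₂ _    | inj₂ u′≡w | _         = inj₂ (u≡w′ , sym u′≡w)
  ... | inj₂ u≡w′ | inj₂ w≡w′ | inj₁ u′≡u | _         = inj₁ (sym u′≡u , w≡w′)

-- The code of a graph

minimal-≡ : ∀ {C : Vec Bool n → Set} {c c′} → MinimalCodeword C c →
            NonzeroCodeword C c′ → c′ ⊆ c → c ≡ c′
minimal-≡ {c′ = c′} (_ , no-smaller) nonzero c′⊆c = ⊆-antisym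
  (λ {k} k∈c → decidable-stable (k ∈? c′) λ k∉c′ →
    no-smaller (c′ , nonzero , c′⊆c , k , k∈c , k∉c′))
  c′⊆c

module GraphCode (G : Graph n) where
  open Graph G using (_~_; _~?_) renaming (sym to ~-sym)

  -- The codeword with message x, namely x followed by xA; every codeword is of
  -- this form by the definition of RowSpan.
  encode : Vec Bool n → Vec Bool (n + n)
  encode x = linearCombination x (generatorMatrix G)

  -- The coordinate of xA at v: the parity of the number of neighbours of v in x.
  neighbourSum : Vec Bool n → Fin n → Bool
  neighbourSum x v = sum λ i → lookup x i ∧ does (i ~? v)

  lookup-encodeˡ : ∀ x i → lookup (encode x) (i ↑ˡ n) ≡ lookup x i
  lookup-encodeˡ x i = begin
    lookup (encode x) (i ↑ˡ n)
      ≡⟨ Vec.lookup∘tabulate _ (i ↑ˡ n) ⟩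
    sum (λ k → lookup x k ∧ lookup (generatorMatrix G k) (i ↑ˡ n))
      ≡⟨ sum-one i off ⟩
    lookup x i ∧ lookup (generatorMatrix G i) (i ↑ˡ n)
      ≡⟨ cong (lookup x i ∧_) (trans (entry i) (dec-true (i ≟ i) refl)) ⟩
    lookup x i ∧ true
      ≡⟨ Bool.∧-identityʳ _ ⟩
    lookup x i ∎
    where
    open ≡-Reasoning
    entry : ∀ k → lookup (generatorMatrix G k) (i ↑ˡ n) ≡ does (k ≟ i)
    entry k = trans (Vec.lookup-++ˡ (identityMatrix G k) _ i) (Vec.lookup∘tabulate _ i)
    off : ∀ k → k ≢ i → lookup x k ∧ lookup (generatorMatrix G k) (i ↑ˡ n) ≡ false
    off k k≢i = trans (cong (lookup x k ∧_) (trans (entry k) (dec-false (k ≟ i) k≢i)))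
                      (Bool.∧-zeroʳ _)

  lookup-encodeʳ : ∀ x v → lookup (encode x) (n ↑ʳ v) ≡ neighbourSum x v
  lookup-encodeʳ x v = trans (Vec.lookup∘tabulate _ (n ↑ʳ v))
    (sum-cong-≗ λ k → cong (lookup x k ∧_)
      (trans (Vec.lookup-++ʳ (identityMatrix G k) _ v) (Vec.lookup∘tabulate _ v)))

  encode-injective : ∀ x y → encode x ≡ encode y → x ≡ y
  encode-injective x y eq = lookup-ext λ i → trans (sym (lookup-encodeˡ x i))
    (trans (cong (λ c → lookup c (i ↑ˡ n)) eq) (lookup-encodeˡ y i))

  encode-𝟎 : encode 𝟎 ≡ 𝟎
  encode-𝟎 = lookup-ext λ j → trans (Vec.lookup∘tabulate _ j)
    (trans (sum-zero λ k → cong (_∧ lookup (generatorMatrix G k) j) (Vec.lookup-replicate k false))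
           (sym (Vec.lookup-replicate j false)))

  encode-⊆⁺ : ∀ x y → (∀ i → lookup x i ≡ true → lookup y i ≡ true) →
    (∀ v → neighbourSum x v ≡ true → neighbourSum y v ≡ true) → encode x ⊆ encode y
  encode-⊆⁺ x y x≤y Ax≤Ay = ⊆⁺ coordinate
    where
    coordinate : ∀ j → lookup (encode x) j ≡ true → lookup (encode y) j ≡ true
    coordinate j with splitAt n j in eq
    ... | inj₁ i with refl ← splitAt⁻¹-↑ˡ eq
      rewrite lookup-encodeˡ x i | lookup-encodeˡ y i = x≤y i
    ... | inj₂ v with refl ← splitAt⁻¹-↑ʳ eq
      rewrite lookup-encodeʳ x v | lookup-encodeʳ y v = Ax≤Ay v

  encode-⊆⁻ˡ : ∀ x y → encode x ⊆ encode y → ∀ i → lookup x i ≡ true → lookup y i ≡ true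
  encode-⊆⁻ˡ x y sub i xi = trans (sym (lookup-encodeˡ y i))
    (⊆⁻ sub (i ↑ˡ n) (trans (lookup-encodeˡ x i) xi))

  encode-⊆⁻ʳ : ∀ x y → encode x ⊆ encode y →
    ∀ v → neighbourSum x v ≡ true → neighbourSum y v ≡ true
  encode-⊆⁻ʳ x y sub v Axv = trans (sym (lookup-encodeʳ y v))
    (⊆⁻ sub (n ↑ʳ v) (trans (lookup-encodeʳ x v) Axv))

  nonzeroCodeword : ∀ x {i} → lookup x i ≡ true → NonzeroCodeword (Code G) (encode x)
  nonzeroCodeword x {i} xi = (x , refl) , λ c≡𝟎 →
    let x≡𝟎 = encode-injective x 𝟎 (trans c≡𝟎 (sym encode-𝟎)) in
    contradiction
      (trans (sym xi) (trans (cong (λ y → lookup y i) x≡𝟎) (Vec.lookup-replicate i false)))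
      λ ()

  -- The list of which M G is the length.
  minimalCodewords : List (Vec Bool (n + n))
  minimalCodewords =
    filter (minimalCodeword? (Code G) (rowSpan? (generatorMatrix G))) (allVectors (n + n))

  ∈-minimalCodewords⁺ : ∀ {c} → MinimalCodeword (Code G) c → c ∈ minimalCodewords
  ∈-minimalCodewords⁺ {c} = ∈-filter⁺ _ (allVectors-complete c)

  ∈-minimalCodewords⁻ : ∀ {c} → c ∈ minimalCodewords → MinimalCodeword (Code G) c
  ∈-minimalCodewords⁻ c∈ = proj₂ (∈-filter⁻
    (minimalCodeword? (Code G) (rowSpan? (generatorMatrix G))) {xs = allVectors (n + n)} c∈)

  minimalCodewords-unique : Unique minimalCodewords
  minimalCodewords-unique = Unique.filter⁺ _ (allVectors-unique (n + n))

  -- The rows of A at u and v overlap. The vertices u and v may be equal, so the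
  -- relation holds between a vertex and itself unless the vertex is isolated.
  CommonNeighbour : Rel (Fin n) 0ℓ
  CommonNeighbour u v = ∃[ w ] u ~ w × v ~ w

  commonNeighbour? : Decidable CommonNeighbour
  commonNeighbour? u v = any? λ w → (u ~? w) ×-dec (v ~? w)

  commonNeighbour-sym : Symmetric CommonNeighbour
  commonNeighbour-sym (w , u~w , v~w) = w , v~w , u~w

  open InducedPaths _≟_ CommonNeighbour commonNeighbour? commonNeighbour-sym public

  -- If p and q are the only neighbours of w in x, then the coordinate of encode x
  -- at w vanishes, so a codeword below it has an even number of p and q.
  link : ∀ x y {p q w} → p ≢ q → p ~ w → q ~ w →
    lookup x p ≡ true → lookup x q ≡ true →
    (∀ {z} → lookup x z ≡ true → z ~ w → z ≡ p ⊎ z ≡ q) →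
    encode y ⊆ encode x → lookup y p ≡ lookup y q
  link x y {p} {q} {w} p≢q p~w q~w xp xq only sub =
    agree (lookup y p) (lookup y q) λ yp+yq → contradiction
      (trans (sym (encode-⊆⁻ʳ y x sub w (trans (at-w y (λ {i} → encode-⊆⁻ˡ y x sub i)) yp+yq)))
             (trans (at-w x λ xi → xi) (cong₂ _xor_ xp xq)))
      λ ()
    where
    at-w : ∀ u → (∀ {i} → lookup u i ≡ true → lookup x i ≡ true) →
           neighbourSum u w ≡ lookup u p xor lookup u q
    at-w u u≤x = trans (sum-two p≢q off) (cong₂ _xor_ (on p~w) (on q~w))
      where
      on : ∀ {i} → i ~ w → lookup u i ∧ does (i ~? w) ≡ lookup u i
      on {i} i~w = trans (cong (lookup u i ∧_) (dec-true (i ~? w) i~w)) (Bool.∧-identityʳ _)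
      off : ∀ i → i ≢ p → i ≢ q → lookup u i ∧ does (i ~? w) ≡ false
      off i i≢p i≢q with lookup u i in ui | i ~? w
      ... | false | _       = refl
      ... | true  | no _    = refl
      ... | true  | yes i~w with only (u≤x ui) i~w
      ...   | inj₁ i≡p = contradiction i≡p i≢p
      ...   | inj₂ i≡q = contradiction i≡q i≢q
    agree : ∀ a b → ¬ (a xor b ≡ true) → a ≡ b
    agree false false _   = refl
    agree false true  a≢b = contradiction refl a≢b
    agree true  false a≢b = contradiction refl a≢b
    agree true  true  _   = refl

  -- A codeword below encode x is constant along an induced path inside x. The
  -- induction runs over final segments of a path, so x may have vertices outside
  -- the segment; it is enough that these have no neighbour in common with a
  -- vertex of the segment after its first.
  constant-along : ∀ x y {u w xs} → encode y ⊆ encode x → InducedPath u w xs →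
    (∀ {z} → z ∈ xs → lookup x z ≡ true) →
    (∀ {z q} → lookup x z ≡ true → z ∉ xs → q ∈ drop 1 xs → ¬ CommonNeighbour z q) →
    ∀ {z} → z ∈ xs → lookup y z ≡ lookup y u
  constant-along x y sub stop           inside outside (here refl) = refl
  constant-along x y sub (step _ _ _ _) inside outside (here refl) = refl
  constant-along x y sub (step {u} {v} {vs = vs} (w , u~w , v~w) u≢v far path)
                 inside outside (there z∈) =
    trans (constant-along x y sub path (inside ∘ there) outside′ z∈)
          (sym (link x y u≢v u~w v~w (inside (here refl)) (inside (there (here refl))) only sub))
    where
    only : ∀ {z} → lookup x z ≡ true → z ~ w → z ≡ u ⊎ z ≡ v
    only {z} xz z~w with z ∈ᴸ? (u ∷ v ∷ vs)
    ... | no z∉                   = contradiction (w , z~w , v~w) (outside xz z∉ (here refl))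
    ... | yes (here z≡u)          = inj₁ z≡u
    ... | yes (there (here z≡v))  = inj₂ z≡v
    ... | yes (there (there z∈′)) = contradiction (inj₂ (w , u~w , z~w)) (All.lookup far z∈′)
    outside′ : ∀ {z q} → lookup x z ≡ true → z ∉ v ∷ vs → q ∈ vs → ¬ CommonNeighbour z q
    outside′ {z} xz z∉ q∈ zq with z ≟ u
    ... | yes refl = contradiction (inj₂ zq) (All.lookup far q∈)
    ... | no  z≢u  =
      outside xz (λ { (here z≡u) → z≢u z≡u ; (there z∈′) → z∉ z∈′ }) (there q∈) zq

  inducedPath-minimal : ∀ {u w xs} → InducedPath u w xs →
    MinimalCodeword (Code G) (encode (indicator xs))
  inducedPath-minimal {u} {w} {xs} path =
    nonzeroCodeword (indicator xs) (indicator⁺ xs (start∈ path)) , no-smaller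
    where
    x : Vec Bool n
    x = indicator xs
    constant : ∀ y → encode y ⊆ encode x → ∀ {i} → lookup x i ≡ true → lookup y i ≡ lookup y u
    constant y sub xi = constant-along x y sub path (indicator⁺ xs)
      (λ xz z∉ → contradiction (indicator⁻ xs xz) z∉) (indicator⁻ xs xi)
    no-smaller : ¬ (∃[ c ] NonzeroCodeword (Code G) c × supp c ⊂ supp (encode x))
    no-smaller (_ , ((y , refl) , c≢𝟎) , c⊂@(c⊆ , _)) with lookup y u in yu
    ... | true  = ⊂-irref (cong encode y≡x) c⊂
      where
      y≡x : y ≡ x
      y≡x = ⊆-antisym (⊆⁺ (encode-⊆⁻ˡ y x c⊆)) (⊆⁺ λ i xi → trans (constant y c⊆ xi) yu)
    ... | false = c≢𝟎 (trans (cong encode y≡𝟎) encode-𝟎)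
      where
      y≡𝟎 : y ≡ 𝟎
      y≡𝟎 = lookup-ext λ i → trans
        (Bool.¬-not λ yi → contradiction
          (trans (sym yi) (trans (constant y c⊆ (encode-⊆⁻ˡ y x c⊆ i yi)) yu)) λ ())
        (sym (Vec.lookup-replicate i false))

  -- A walk of even length is a walk of common neighbours; a walk of odd length
  -- becomes one after its first step.
  halve : ∀ {u v} → Star _~_ u v →
    Star CommonNeighbour u v ⊎ ∃[ w ] (u ~ w × Star CommonNeighbour w v)
  halve ε = inj₁ ε
  halve (u~w ◅ walk) with halve walk
  ... | inj₁ even             = inj₂ (_ , u~w , even)
  ... | inj₂ (w , v~w , even) = inj₁ ((_ , u~w , ~-sym v~w) ◅ even)

  -- The codeword of the vertex set of an induced path with the given ends.
  PathCodeword : Fin n × Fin n → Vec Bool (n + n) → Set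
  PathCodeword (u , v) c = ∃[ xs ] InducedPath u v xs × c ≡ encode (indicator xs)

  pathCodeword-ends : ∀ {p q c} → PathCodeword p c → PathCodeword q c → p ≈ q
  pathCodeword-ends (xs , P , refl) (ys , Q , eq) = same-ends P Q
    (λ z∈ → indicator⁻ ys (trans (sym (cong (λ x → lookup x _) same)) (indicator⁺ xs z∈)))
    (λ z∈ → indicator⁻ xs (trans (cong (λ x → lookup x _) same) (indicator⁺ ys z∈)))
    where
    same : indicator xs ≡ indicator ys
    same = encode-injective (indicator xs) (indicator ys) eq

  module LowerBound (connected : Connected G) (root : Fin n) where

    -- Whether the walk to v provided by connectedness has even length. In a
    -- graph with an odd cycle this depends on the walk, but the two classes are
    -- still each joined by walks of even length.
    evenWalk : Fin n → Bool
    evenWalk v with halve (connected root v)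
    ... | inj₁ _ = true
    ... | inj₂ _ = false

    same-parity : ∀ {u v} → evenWalk u ≡ evenWalk v → Star CommonNeighbour u v
    same-parity {u} {v} eq with halve (connected root u) | halve (connected root v)
    ... | inj₁ even₁ | inj₁ even₂ = reverse commonNeighbour-sym even₁ ◅◅ even₂
    ... | inj₂ (w₁ , r~w₁ , even₁) | inj₂ (w₂ , r~w₂ , even₂) =
      reverse commonNeighbour-sym even₁ ◅◅ (root , ~-sym r~w₁ , ~-sym r~w₂) ◅ even₂

    triangles≤M : triangle (length (colourClass evenWalk true))
                + triangle (length (colourClass evenWalk false)) ≤ M G
    triangles≤M = subst (_≤ M G) (length-monochromaticPairs evenWalk)
      (pigeonhole {P = PathCodeword} (λ p≉q p q → p≉q (pathCodeword-ends p q))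
        (monochromaticPairs-apart evenWalk)
        (All.map (λ same → let xs , path = inducedPath (same-parity same) in
            encode (indicator xs) , ∈-minimalCodewords⁺ (inducedPath-minimal path) , xs , path , refl)
          (monochromatic evenWalk)))

-- The hypothesis n ≥ 1 provides the root of the walks.
M≥quarter-square : n ≥ 1 → (G : Graph n) → Connected G → (n + 1) ^ 2 / 4 ≤ M G
M≥quarter-square {suc m} _ G connected = ℕ.≤-trans
  (subst (λ k → (k + 1) ^ 2 / 4 ≤ triangle a + triangle b)
    (colourClasses-partition evenWalk) (quarter-square≤ a b))
  triangles≤M
  where
  open GraphCode G
  open LowerBound connected zero
  a b : ℕ
  a = length (colourClass evenWalk true)
  b = length (colourClass evenWalk false)

-- Complete bipartite graphs

-- The complete bipartite graph whose sides are the two colour classes of κ.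
bipartite : (Fin n → Bool) → Graph n
bipartite κ = record
  { _~_    = λ i j → κ i ≢ κ j
  ; _~?_   = λ i j → ¬? (κ i Bool.≟ κ j)
  ; sym    = λ i≢j → i≢j ∘ sym
  ; irrefl = λ { refl i≢i → i≢i refl }
  }

module Bipartite (κ : Fin n → Bool) where
  G : Graph n
  G = bipartite κ

  open GraphCode G

  open Graph G using (_~_; _~?_)

  -- The codeword of the vertex set of i and j, a singleton when i = j.
  pairCodeword : Fin n × Fin n → Vec Bool (n + n)
  pairCodeword (i , j) = encode (indicator (i ∷ j ∷ []))

  -- A vertex v sees the side opposite to its own; if i is the only vertex of x
  -- there, then v has exactly one neighbour in x.
  neighbourSum-single : ∀ x i v → lookup x i ≡ true → i ~ v →
    (∀ k → k ≢ i → lookup x k ≡ true → κ k ≢ κ i) → neighbourSum x v ≡ true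
  neighbourSum-single x i v xi i~v alone = trans (sum-one i off)
    (cong₂ _∧_ xi (dec-true (i ~? v) i~v))
    where
    two-colours : ∀ {a b c : Bool} → a ≢ c → b ≢ c → a ≡ b
    two-colours a≢c b≢c = Bool.not-injective
      (trans (sym (Bool.¬-not (a≢c ∘ sym))) (Bool.¬-not (b≢c ∘ sym)))
    off : ∀ k → k ≢ i → lookup x k ∧ does (k ~? v) ≡ false
    off k k≢i with lookup x k in xk
    ... | false = refl
    ... | true  = dec-false (k ~? v) λ k~v → alone k k≢i xk (two-colours k~v i~v)

  -- A vertex is adjacent to both of two vertices on the same side, or to neither.
  neighbourSum-double : ∀ {i j} v → i ≢ j → κ i ≡ κ j →
    neighbourSum (indicator (i ∷ j ∷ [])) v ≡ false
  neighbourSum-double {i} {j} v i≢j κi≡κj = begin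
    neighbourSum x v
      ≡⟨ sum-two i≢j off ⟩
    (lookup x i ∧ adjacent (κ i)) xor (lookup x j ∧ adjacent (κ j))
      ≡⟨ cong₂ (λ a b → (a ∧ adjacent (κ i)) xor (b ∧ adjacent (κ j)))
               (indicator⁺ (i ∷ j ∷ []) (here refl))
               (indicator⁺ (i ∷ j ∷ []) (there (here refl))) ⟩
    adjacent (κ i) xor adjacent (κ j)
      ≡⟨ cong (λ b → adjacent b xor adjacent (κ j)) κi≡κj ⟩
    adjacent (κ j) xor adjacent (κ j)
      ≡⟨ Bool.xor-same (adjacent (κ j)) ⟩
    false ∎
    where
    open ≡-Reasoning
    x : Vec Bool n
    x = indicator (i ∷ j ∷ [])
    adjacent : Bool → Bool
    adjacent b = does (¬? (b Bool.≟ κ v))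
    off : ∀ k → k ≢ i → k ≢ j → lookup x k ∧ does (k ~? v) ≡ false
    off k k≢i k≢j with lookup x k in xk
    ... | false = refl
    ... | true with indicator⁻ (i ∷ j ∷ []) xk
    ...   | here k≡i         = contradiction k≡i k≢i
    ...   | there (here k≡j) = contradiction k≡j k≢j

  pairCodeword-nonzero : ∀ i j → NonzeroCodeword (Code G) (pairCodeword (i , j))
  pairCodeword-nonzero i j =
    nonzeroCodeword (indicator (i ∷ j ∷ [])) (indicator⁺ (i ∷ j ∷ []) (here refl))

  pairCodeword-⊆ : ∀ x {i j} → i ≢ j → κ i ≡ κ j →
    lookup x i ≡ true → lookup x j ≡ true → pairCodeword (i , j) ⊆ encode x
  pairCodeword-⊆ x {i} {j} i≢j κi≡κj xi xj = encode-⊆⁺ (indicator (i ∷ j ∷ [])) x members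
    λ v Av → contradiction (trans (sym Av) (neighbourSum-double v i≢j κi≡κj)) λ ()
    where
    members : ∀ k → lookup (indicator (i ∷ j ∷ [])) k ≡ true → lookup x k ≡ true
    members k k∈ with indicator⁻ (i ∷ j ∷ []) k∈
    ... | here refl         = xi
    ... | there (here refl) = xj

  singleCodeword-⊆ : ∀ x {i} → lookup x i ≡ true →
    (∀ k → k ≢ i → lookup x k ≡ true → κ k ≢ κ i) → pairCodeword (i , i) ⊆ encode x
  singleCodeword-⊆ x {i} xi alone = encode-⊆⁺ (indicator (i ∷ i ∷ [])) x members
    λ v Av → neighbourSum-single x i v xi (adjacent v Av) alone
    where
    only : ∀ {k} → lookup (indicator (i ∷ i ∷ [])) k ≡ true → k ≡ i
    only k∈ with indicator⁻ (i ∷ i ∷ []) k∈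
    ... | here k≡i         = k≡i
    ... | there (here k≡i) = k≡i
    members : ∀ k → lookup (indicator (i ∷ i ∷ [])) k ≡ true → lookup x k ≡ true
    members k k∈ = trans (cong (lookup x) (only k∈)) xi
    adjacent : ∀ v → neighbourSum (indicator (i ∷ i ∷ [])) v ≡ true → i ~ v
    adjacent v Av with i ~? v
    ... | yes i~v = i~v
    ... | no ¬i~v = contradiction (trans (sym Av) (sum-zero vanish)) λ ()
      where
      vanish : ∀ k → lookup (indicator (i ∷ i ∷ [])) k ∧ does (k ~? v) ≡ false
      vanish k with lookup (indicator (i ∷ i ∷ [])) k in k∈
      ... | false = refl
      ... | true  = dec-false (k ~? v) (subst (λ k → ¬ (k ~ v)) (sym (only k∈)) ¬i~v)

  -- A vertex i of x either shares its side with another vertex j of x or is alone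
  -- in x on its side.
  minimal⇒pairCodeword : ∀ {c} → MinimalCodeword (Code G) c →
    ∃[ i ] ∃[ j ] κ i ≡ κ j × c ≡ pairCodeword (i , j)
  minimal⇒pairCodeword minimal@(((x , refl) , c≢𝟎) , _)
    with any? (λ i → lookup x i Bool.≟ true)
  ... | no ¬member = contradiction (trans (cong encode x≡𝟎) encode-𝟎) c≢𝟎
    where
    x≡𝟎 : x ≡ 𝟎
    x≡𝟎 = lookup-ext λ i → trans (Bool.¬-not λ xi → ¬member (i , xi))
                                 (sym (Vec.lookup-replicate i false))
  ... | yes (i , xi)
    with any? (λ j → ¬? (j ≟ i) ×-dec ((lookup x j Bool.≟ true) ×-dec (κ j Bool.≟ κ i)))
  ... | yes (j , j≢i , xj , κj≡κi) = i , j , sym κj≡κi , minimal-≡ minimal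
    (pairCodeword-nonzero i j) (pairCodeword-⊆ x (j≢i ∘ sym) (sym κj≡κi) xi xj)
  ... | no alone = i , i , refl , minimal-≡ minimal
    (pairCodeword-nonzero i i)
    (singleCodeword-⊆ x xi λ k k≢i xk κk≡κi → alone (k , k≢i , xk , κk≡κi))

  M≤triangles : M G ≤ triangle (length (colourClass κ true))
                    + triangle (length (colourClass κ false))
  M≤triangles = subst (M G ≤_)
    (trans (length-map pairCodeword (monochromaticPairs κ)) (length-monochromaticPairs κ))
    (Unique⇒length≤ minimalCodewords-unique λ c∈ → listed (∈-minimalCodewords⁻ c∈))
    where
    listed : ∀ {c} → MinimalCodeword (Code G) c → c ∈ map pairCodeword (monochromaticPairs κ)
    listed minimal with minimal⇒pairCodeword minimal
    ... | i , j , κi≡κj , refl with ∈-monochromaticPairs κ κi≡κj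
    ...   | inj₁ ij∈ = ∈-map⁺ pairCodeword ij∈
    ...   | inj₂ ji∈ = subst (_∈ map pairCodeword (monochromaticPairs κ))
      (cong encode (indicator-swap j i)) (∈-map⁺ pairCodeword ji∈)

-- The parity of a vertex; as a colouring its classes have n/2 elements, rounded
-- up for the even vertices and rounded down for the odd ones.
isEven : Fin n → Bool
isEven zero          = true
isEven (suc zero)    = false
isEven (suc (suc i)) = isEven i

-- The vertices are listed by a function f so that the induction can pass from n
-- to n + 2.
balanced : (κ : A → Bool) (f : Fin n → A) → (∀ i → κ (f i) ≡ isEven i) →
  length (filter (λ a → κ a Bool.≟ true) (tabulate f)) ≡ ⌈ n /2⌉ ×
  length (filter (λ a → κ a Bool.≟ false) (tabulate f)) ≡ ⌊ n /2⌋
balanced {n = 0} κ f _ = refl , refl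
balanced {n = 1} κ f κf rewrite κf zero = refl , refl
balanced {n = suc (suc n)} κ f κf rewrite κf zero | κf (suc zero) =
  let even , odd = balanced κ (λ i → f (suc (suc i))) (λ i → κf (suc (suc i)))
  in  cong suc even , cong suc odd

balancedBipartite : ∀ n → Graph n
balancedBipartite n = bipartite isEven

-- Vertices on the same side are joined through vertex 0 or vertex 1, whichever
-- lies on the other side.
balancedBipartite-connected : ∀ n → Connected (balancedBipartite n)
balancedBipartite-connected 1             zero zero = ε
balancedBipartite-connected (suc (suc n)) u    v    with isEven u in κu | isEven v in κv
... | true  | false = (λ eq → contradiction (trans (sym κu) (trans eq κv)) λ ()) ◅ ε
... | false | true  = (λ eq → contradiction (trans (sym κu) (trans eq κv)) λ ()) ◅ ε
... | true  | true  = _◅_ {j = suc zero} (λ eq → contradiction (trans (sym κu) eq) λ ())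
                        ((λ eq → contradiction (trans eq κv) λ ()) ◅ ε)
... | false | false = _◅_ {j = zero} (λ eq → contradiction (trans (sym κu) eq) λ ())
                        ((λ eq → contradiction (trans eq κv) λ ()) ◅ ε)

M-balancedBipartite≤ : ∀ n → M (balancedBipartite n) ≤ (n + 1) ^ 2 / 4
M-balancedBipartite≤ n =
  subst (M (balancedBipartite n) ≤_)
    (trans (cong₂ (λ a b → triangle a + triangle b) (proj₁ sizes) (proj₂ sizes))
           (sym (quarter-square-triangle n)))
    (Bipartite.M≤triangles {n} isEven)
  where
  sizes : length (colourClass {n} isEven true) ≡ ⌈ n /2⌉ ×
          length (colourClass {n} isEven false) ≡ ⌊ n /2⌋
  sizes = balanced {n = n} isEven (λ i → i) (λ _ → refl)

theorem4p1 : (n : ℕ) → n ≥ 1 →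
    (((n + 1) ^ 2 / 4) IsMinimumOf (λ k → ∃[ G ] (Connected {n} G × M G ≡ k)))
    × ((n + 1) ^ 2 / 4 ≡ ⌊ n + 1 /2⌋ * ⌈ n + 1 /2⌉)
theorem4p1 n n≥1 =
  ( ( K , balancedBipartite-connected n
    , ℕ.≤-antisym (M-balancedBipartite≤ n) (M≥quarter-square n≥1 K (balancedBipartite-connected n)))
  , λ { j (G , connected , refl) → M≥quarter-square n≥1 G connected })
  , quarter-square-product n
  where
  K : Graph n
  K = balancedBipartite n
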